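{- Let $0 \le p \le 1$ and let $n$ be even. Inserting the pairs sequence $2,1,4,3,6,5,\ldots,n,n-1$ into an initially empty binary search tree, applying \textsc{RebalanceZigZag} after each insertion, results in a binary search tree whose expected average node depth is $\Theta(n)$.
   Context: Each new element is first placed as a new leaf $v$ at its standard unbalanced BST position, and then \textsc{RebalanceZigZag}$(v)$ is applied: while $v$ has a parent and an independent coin flip shows tail (tail has probability $p$, head probability $1-p$), set $v\gets$ parent of $v$. Afterwards, if $v$ has a parent and a grandparent: if $v$ and its parent are both left children or both right children, rotate the parent of $v$ up once; otherwise rotate $v$ up twice. ("Rotating $x$ up" is the standard single rotation at the parent of $x$ that moves $x$ one level up.) The depth of a node is the number of edges from it to the root; the average node depth is the sum of depths of all $n$ nodes divided by $n$. Expectation is over the coin flips.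
   Formalization: The tail probability p is taken to be a rational number with 0 ≤ p ≤ 1, instead of an arbitrary real number in that range. -}

module Defs where

open import Data.Nat as ℕ using (ℕ; zero; suc; _<ᵇ_)
open import Data.Bool using (true; false; if_then_else_)
open import Data.Integer using (+_)
open import Data.Rational using (ℚ; _/_; _+_; _*_; _-_; 0ℚ; 1ℚ)
open import Data.List using (List; []; _∷_; _++_; map; concatMap; foldr; reverse)
open import Data.Product using (_×_; _,_)

data Tree : Set where
  leaf : Tree
  node : Tree → ℕ → Tree → Tree

data Dir : Set where
  L R : Dir

-- Standard unbalanced BST insertion of a new leaf; also returns the path
-- from the root to the new node (list of directions, root first).
-- (A key already present leaves the tree unchanged; never happens here.)
insert : ℕ → Tree → Tree × List Dir
insert k leaf = node leaf k leaf , []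
insert k (node l x r) with k <ᵇ x | x <ᵇ k
... | true  | _ with insert k l
...   | l' , ps = node l' x r , L ∷ ps
insert k (node l x r) | false | true with insert k r
...   | r' , ps = node l x r' , R ∷ ps
insert k (node l x r) | false | false = node l x r , []

modifyAt : List Dir → (Tree → Tree) → Tree → Tree
modifyAt []       f t            = f t
modifyAt (_ ∷ _)  f leaf         = leaf
modifyAt (L ∷ ds) f (node l x r) = node (modifyAt ds f l) x r
modifyAt (R ∷ ds) f (node l x r) = node l x (modifyAt ds f r)

rotUp : Dir → Tree → Tree
rotUp L (node (node a x b) y c) = node a x (node b y c)
rotUp R (node a x (node b y c)) = node (node a x b) y c
rotUp _ t = t

-- "Rotate x up" for the node x whose path root-to-parent is ps and which is
-- the d-child of its parent: rotation at the parent.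
rotateUp : List Dir → Dir → Tree → Tree
rotateUp ps d = modifyAt ps (rotUp d)

-- Rebalancing step for v given by its REVERSED path (v-to-root directions:
-- first entry = direction of v below its parent, second = direction of the
-- parent below the grandparent, ...).  Only acts if v has parent and grandparent.
rebalanceAt : List Dir → Tree → Tree
rebalanceAt (L ∷ L ∷ rest) t = rotateUp (reverse rest) L t
rebalanceAt (R ∷ R ∷ rest) t = rotateUp (reverse rest) R t
rebalanceAt (d2 ∷ d1 ∷ rest) t =
  rotateUp (reverse rest) d1 (rotateUp (reverse (d1 ∷ rest)) d2 t)
rebalanceAt _ t = t

Dist : Set → Set
Dist A = List (ℚ × A)

return : {A : Set} → A → Dist A
return a = (1ℚ , a) ∷ []

scale : {A : Set} → ℚ → Dist A → Dist A
scale q = map (λ { (r , a) → (q * r , a) })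

bind : {A B : Set} → Dist A → (A → Dist B) → Dist B
bind d f = concatMap (λ { (q , a) → scale q (f a) }) d

expect : {A : Set} → (A → ℚ) → Dist A → ℚ
expect f d = foldr (λ { (q , a) acc → q * f a + acc }) 0ℚ d

-- Random walk of RebalanceZigZag: v given by reversed path; while v has a
-- parent, a coin shows tail with prob. p (then v ← parent) or head with
-- prob. 1 - p (then stop).
walk : ℚ → List Dir → Dist (List Dir)
walk p []       = return []
walk p (d ∷ ds) = scale p (walk p ds) ++ scale (1ℚ - p) (return (d ∷ ds))

insertStep : ℚ → ℕ → Tree → Dist Tree
insertStep p k t with insert k t
... | t' , path = bind (walk p (reverse path)) (λ v → return (rebalanceAt v t'))

insertAll : ℚ → List ℕ → Tree → Dist Tree
insertAll p []       t = return t
insertAll p (k ∷ ks) t = bind (insertStep p k t) (insertAll p ks)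

pairsSeq : ℕ → List ℕ
pairsSeq zero    = []
pairsSeq (suc m) = pairsSeq m ++ (2 ℕ.* suc m ∷ 2 ℕ.* suc m ℕ.∸ 1 ∷ [])

depthSumFrom : ℕ → Tree → ℕ
depthSumFrom d leaf         = 0
depthSumFrom d (node l x r) = d ℕ.+ depthSumFrom (suc d) l ℕ.+ depthSumFrom (suc d) r

depthSum : Tree → ℕ
depthSum = depthSumFrom 0

-- Average node depth of a tree with suc k nodes.
avgDepth : (k : ℕ) → Tree → ℚ
avgDepth k t = (+ depthSum t) / suc k

-- Expected average node depth after inserting the pairs sequence of length
-- n = 2 (suc m) into an empty tree (n even, n ≥ 2).
expectedAvgDepthPairs : ℚ → ℕ → ℚ
expectedAvgDepthPairs p m =
  expect (avgDepth (suc (2 ℕ.* m))) (insertAll p (pairsSeq (suc m)) leaf)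

{-# OPTIONS --safe #-}
module Submission where

open import Defs
open import Data.Bool using (true; false)
open import Data.Empty using (⊥-elim)
open import Data.Nat as ℕ using (ℕ; zero; suc)
import Data.Nat.Properties as ℕ
import Data.Nat.Solver as ℕ
open import Data.Integer as ℤ using (+_)
import Data.Integer.Properties as ℤ
open import Data.Rational as ℚ using (ℚ; _/_; _+_; _*_; _-_; _≤_; _<_; 0ℚ; 1ℚ; ½; nonNegative; positive)
open import Data.Rational.Properties as ℚ using (≤-refl; ≤-trans; ≤-reflexive; +-mono-≤)
open import Data.Rational.Solver using (module +-*-Solver)
import Data.Rational.Unnormalised as ℚᵘ
import Data.Rational.Unnormalised.Properties as ℚᵘ
open import Data.List using (List; []; _∷_; _++_; length; replicate; reverse)
open import Data.List.Properties using (length-++; reverse-++; ++-identityʳ; unfold-reverse)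
open import Data.Product using (_×_; _,_; ∃-syntax; proj₁; proj₂)
open import Data.Sum using (inj₁; inj₂)
open import Relation.Binary.Definitions using (tri<; tri≈; tri>)
open import Relation.Binary.PropositionalEquality using (_≡_; refl; sym; trans; cong; cong₂; subst; module ≡-Reasoning)

-- Both keys of a pair are inserted at the end of the right spine, and a rebalancing either
-- merges two adjacent spine nodes or leaves the spine length alone.  Let S be the number of
-- nodes on the right spine, G = S ∸ 2, and let X be the number of edges on the leftmost path
-- from the root; X grows by one each time the root is merged into its right child.
-- Conditionally on the tree, inserting one pair changes G by at most p (2 p^G − 1) and X by
-- at least (1 − p) p^G in expectation, so 2 p X − (1 − p) G gains at least p (1 − p) per
-- pair: the unknown p^G cancels.  As G ≥ 0, this gives E X ≥ (1 − p) m / 2 after m pairs when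
-- 0 < p < 1; for p = 0 the excess G stays 0, and for p = 1 the right spine itself grows by
-- one per pair.  A path with X edges from the root forces depth sum ≥ X² / 2, and Jensen's
-- inequality turns the linear bound on E X into a quadratic one on the expected depth sum.
-- The upper bound is the trivial one: n nodes have depth sum at most n².

-- Trees

pattern single k = node leaf k leaf

rightSpine leftSpine rightEdges leftEdges size : Tree → ℕ
rightSpine leaf         = 0
rightSpine (node _ _ r) = suc (rightSpine r)
leftSpine leaf         = 0
leftSpine (node l _ _) = suc (leftSpine l)
rightEdges leaf         = 0
rightEdges (node _ _ r) = rightSpine r
leftEdges leaf         = 0
leftEdges (node l _ _) = leftSpine l
size leaf         = 0
size (node l _ r) = suc (size l ℕ.+ size r)

-- Twice the sum of the depths `d + 1`, ..., `d + s` is `s² + s + 2 d s`. Dropping the lone `s`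
-- leaves a bound that survives adding one node at the top.
spine-step : ∀ d s e → s ℕ.* s ℕ.+ 2 ℕ.* suc d ℕ.* s ℕ.≤ 2 ℕ.* e →
  suc s ℕ.* suc s ℕ.+ 2 ℕ.* d ℕ.* suc s ℕ.≤ 2 ℕ.* (suc d ℕ.+ e)
spine-step d s e h = begin
  suc s ℕ.* suc s ℕ.+ 2 ℕ.* d ℕ.* suc s
    ≤⟨ ℕ.n≤1+n _ ⟩
  suc (suc s ℕ.* suc s ℕ.+ 2 ℕ.* d ℕ.* suc s)
    ≡⟨ solve 2 (λ s d → con 1 :+ ((con 1 :+ s) :* (con 1 :+ s) :+ con 2 :* d :* (con 1 :+ s))
         := con 2 :* (con 1 :+ d) :+ (s :* s :+ con 2 :* (con 1 :+ d) :* s)) refl s d ⟩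
  2 ℕ.* suc d ℕ.+ (s ℕ.* s ℕ.+ 2 ℕ.* suc d ℕ.* s)
    ≤⟨ ℕ.+-monoʳ-≤ (2 ℕ.* suc d) h ⟩
  2 ℕ.* suc d ℕ.+ 2 ℕ.* e
    ≡⟨ ℕ.*-distribˡ-+ 2 (suc d) e ⟨
  2 ℕ.* (suc d ℕ.+ e) ∎
  where
  open ℕ.≤-Reasoning
  open ℕ.+-*-Solver

leftSpine-depth : ∀ d t →
  leftSpine t ℕ.* leftSpine t ℕ.+ 2 ℕ.* d ℕ.* leftSpine t ℕ.≤ 2 ℕ.* depthSumFrom (suc d) t
leftSpine-depth d leaf         = ℕ.≤-reflexive (ℕ.*-zeroʳ (2 ℕ.* d))
leftSpine-depth d (node l x r) = ℕ.≤-trans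
  (spine-step d (leftSpine l) _ (leftSpine-depth (suc d) l))
  (ℕ.*-monoʳ-≤ 2 (ℕ.m≤m+n (suc d ℕ.+ depthSumFrom (suc (suc d)) l) _))

rightSpine-depth : ∀ d t →
  rightSpine t ℕ.* rightSpine t ℕ.+ 2 ℕ.* d ℕ.* rightSpine t ℕ.≤ 2 ℕ.* depthSumFrom (suc d) t
rightSpine-depth d leaf         = ℕ.≤-reflexive (ℕ.*-zeroʳ (2 ℕ.* d))
rightSpine-depth d (node l x r) = ℕ.≤-trans
  (spine-step d (rightSpine r) _ (rightSpine-depth (suc d) r))
  (ℕ.*-monoʳ-≤ 2 (ℕ.+-monoˡ-≤ _ (ℕ.m≤m+n (suc d) (depthSumFrom (suc (suc d)) l))))

leftEdges²≤2depthSum : ∀ t → leftEdges t ℕ.* leftEdges t ℕ.≤ 2 ℕ.* depthSum t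
leftEdges²≤2depthSum leaf         = ℕ.z≤n
leftEdges²≤2depthSum (node l x r) = ℕ.≤-trans (ℕ.≤-reflexive (sym (ℕ.+-identityʳ _)))
  (ℕ.≤-trans (leftSpine-depth 0 l) (ℕ.*-monoʳ-≤ 2 (ℕ.m≤m+n (depthSumFrom 1 l) _)))

rightEdges²≤2depthSum : ∀ t → rightEdges t ℕ.* rightEdges t ℕ.≤ 2 ℕ.* depthSum t
rightEdges²≤2depthSum leaf         = ℕ.z≤n
rightEdges²≤2depthSum (node l x r) = ℕ.≤-trans (ℕ.≤-reflexive (sym (ℕ.+-identityʳ _)))
  (ℕ.≤-trans (rightSpine-depth 0 r) (ℕ.*-monoʳ-≤ 2 (ℕ.m≤n+m _ (depthSumFrom 1 l))))

rightSpine≤1+rightEdges : ∀ t → rightSpine t ℕ.≤ 1 ℕ.+ rightEdges t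
rightSpine≤1+rightEdges leaf         = ℕ.z≤n
rightSpine≤1+rightEdges (node _ _ _) = ℕ.≤-refl

-- In a tree of `n` nodes with its root at depth `d`, no node is deeper than `d + n`.
depthSumFrom≤ : ∀ d t → depthSumFrom d t ℕ.≤ size t ℕ.* (d ℕ.+ size t)
depthSumFrom≤ d leaf         = ℕ.z≤n
depthSumFrom≤ d (node l x r) = begin
  d ℕ.+ depthSumFrom (suc d) l ℕ.+ depthSumFrom (suc d) r
    ≤⟨ ℕ.+-mono-≤ (ℕ.+-monoʳ-≤ d (depthSumFrom≤ (suc d) l)) (depthSumFrom≤ (suc d) r) ⟩
  d ℕ.+ a ℕ.* (suc d ℕ.+ a) ℕ.+ b ℕ.* (suc d ℕ.+ b)
    ≤⟨ ℕ.m≤m+n _ (suc (a ℕ.+ b ℕ.+ 2 ℕ.* a ℕ.* b)) ⟩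
  d ℕ.+ a ℕ.* (suc d ℕ.+ a) ℕ.+ b ℕ.* (suc d ℕ.+ b) ℕ.+ suc (a ℕ.+ b ℕ.+ 2 ℕ.* a ℕ.* b)
    ≡⟨ solve 3 (λ d a b → d :+ a :* (con 1 :+ d :+ a) :+ b :* (con 1 :+ d :+ b)
           :+ (con 1 :+ (a :+ b :+ con 2 :* a :* b))
         := (con 1 :+ (a :+ b)) :* (d :+ (con 1 :+ (a :+ b)))) refl d a b ⟩
  suc (a ℕ.+ b) ℕ.* (d ℕ.+ suc (a ℕ.+ b)) ∎
  where
  open ℕ.≤-Reasoning
  open ℕ.+-*-Solver
  a = size l
  b = size r

-- Tree sizes under rotation and insertion

size-modifyAt : ∀ ps {f} → (∀ t → size (f t) ≡ size t) → ∀ t → size (modifyAt ps f t) ≡ size t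
size-modifyAt []       f≡ t            = f≡ t
size-modifyAt (_ ∷ _)  f≡ leaf         = refl
size-modifyAt (L ∷ ps) f≡ (node l x r) = cong (λ n → suc (n ℕ.+ size r)) (size-modifyAt ps f≡ l)
size-modifyAt (R ∷ ps) f≡ (node l x r) = cong (λ n → suc (size l ℕ.+ n)) (size-modifyAt ps f≡ r)

size-rotUp : ∀ d t → size (rotUp d t) ≡ size t
size-rotUp L leaf                        = refl
size-rotUp L (node leaf _ _)             = refl
size-rotUp L (node (node a x b) y c)     = cong suc (trans (ℕ.+-suc _ _) (cong suc (sym (ℕ.+-assoc (size a) _ _))))
size-rotUp R leaf                        = refl
size-rotUp R (node _ _ leaf)             = refl
size-rotUp R (node a x (node b y c))     = cong suc (trans (cong suc (ℕ.+-assoc (size a) _ _)) (sym (ℕ.+-suc _ _)))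

size-rebalanceAt : ∀ v t → size (rebalanceAt v t) ≡ size t
size-rebalanceAt []             t = refl
size-rebalanceAt (L ∷ [])       t = refl
size-rebalanceAt (R ∷ [])       t = refl
size-rebalanceAt (L ∷ L ∷ rest) t = size-modifyAt (reverse rest) (size-rotUp L) t
size-rebalanceAt (R ∷ R ∷ rest) t = size-modifyAt (reverse rest) (size-rotUp R) t
size-rebalanceAt (L ∷ R ∷ rest) t = trans (size-modifyAt (reverse rest) (size-rotUp R) _)
                                          (size-modifyAt (reverse (R ∷ rest)) (size-rotUp L) t)
size-rebalanceAt (R ∷ L ∷ rest) t = trans (size-modifyAt (reverse rest) (size-rotUp L) _)
                                          (size-modifyAt (reverse (L ∷ rest)) (size-rotUp R) t)

-- The inequality covers the branch where the key is already present, and it suffices for the upper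
-- bound.
size-insert : ∀ k t → size (proj₁ (insert k t)) ℕ.≤ suc (size t)
size-insert k leaf = ℕ.≤-refl
size-insert k (node l x r) with k ℕ.<ᵇ x | x ℕ.<ᵇ k
... | true  | _     = ℕ.s≤s (ℕ.+-monoˡ-≤ (size r) (size-insert k l))
... | false | true  = ℕ.s≤s (ℕ.≤-trans (ℕ.+-monoʳ-≤ (size l) (size-insert k r)) (ℕ.≤-reflexive (ℕ.+-suc _ _)))
... | false | false = ℕ.n≤1+n _

-- Right spines

-- Only the keys on the right spine are recorded: a key of at least `k` is compared with these alone
-- on its way to the end of the spine.
data Below (k : ℕ) : ℕ → Tree → Set where
  []  : Below k 0 leaf
  _∷_ : ∀ {s l x r} → x ℕ.< k → Below k s r → Below k (suc s) (node l x r)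

Below-rightSpine : ∀ {k s t} → Below k s t → rightSpine t ≡ s
Below-rightSpine []      = refl
Below-rightSpine (_ ∷ b) = cong suc (Below-rightSpine b)

graft : Tree → Tree → Tree
graft c leaf         = c
graft c (node l x r) = node l x (graft c r)

graft-leaf : ∀ t → graft leaf t ≡ t
graft-leaf leaf         = refl
graft-leaf (node l x r) = cong (node l x) (graft-leaf r)

Below-graft : ∀ {k k′ s s′ c t} → k ℕ.≤ k′ → Below k′ s′ c → Below k s t →
  Below k′ (s′ ℕ.+ s) (graft c t)
Below-graft {k′ = k′} {s′ = s′} {c = c} k≤k′ b′ [] =
  subst (λ n → Below k′ n c) (sym (ℕ.+-identityʳ s′)) b′
Below-graft {k′ = k′} {s′ = s′} {c = c} {t = t} k≤k′ b′ (x<k ∷ b) =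
  subst (λ n → Below k′ n (graft c t)) (sym (ℕ.+-suc s′ _)) (ℕ.<-≤-trans x<k k≤k′ ∷ Below-graft k≤k′ b′ b)

<⇒<ᵇ≡true : ∀ {m n} → m ℕ.< n → (m ℕ.<ᵇ n) ≡ true
<⇒<ᵇ≡true {zero}  (ℕ.s≤s _) = refl
<⇒<ᵇ≡true {suc m} (ℕ.s≤s p) = <⇒<ᵇ≡true p

≤⇒>ᵇ≡false : ∀ {m n} → m ℕ.≤ n → (n ℕ.<ᵇ m) ≡ false
≤⇒>ᵇ≡false {n = zero}  ℕ.z≤n     = refl
≤⇒>ᵇ≡false {n = suc _} ℕ.z≤n     = refl
≤⇒>ᵇ≡false             (ℕ.s≤s p) = ≤⇒>ᵇ≡false p

insert-right : ∀ {n l x r r′ ps} → x ℕ.< n → insert n r ≡ (r′ , ps) →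
  insert n (node l x r) ≡ (node l x r′ , R ∷ ps)
insert-right x<n eq rewrite ≤⇒>ᵇ≡false (ℕ.<⇒≤ x<n) | <⇒<ᵇ≡true x<n | eq = refl

insert-left : ∀ {n l x r l′ ps} → n ℕ.< x → insert n l ≡ (l′ , ps) →
  insert n (node l x r) ≡ (node l′ x r , L ∷ ps)
insert-left n<x eq rewrite <⇒<ᵇ≡true n<x | eq = refl

insert-graft : ∀ {k n s t c c′ ps} → k ℕ.≤ n → Below k s t → insert n c ≡ (c′ , ps) →
  insert n (graft c t) ≡ (graft c′ t , replicate s R ++ ps)
insert-graft k≤n []      eq = eq
insert-graft k≤n (x ∷ b) eq = insert-right (ℕ.<-≤-trans x k≤n) (insert-graft k≤n b eq)

-- Spine node `j`, counted from 0 at the root, leaves the spine and becomes the left child of its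
-- successor.
merge : ℕ → Tree → Tree
merge j = modifyAt (replicate j R) (rotUp R)

Below-merge : ∀ {k s t j} → j ℕ.≤ s → Below k (suc (suc s)) t → Below k (suc s) (merge j t)
Below-merge {j = zero}  _         (x ∷ y ∷ b) = y ∷ b
Below-merge {j = suc j} (ℕ.s≤s h) (x ∷ b)     = x ∷ Below-merge h b

-- By `j ≤ s` both rotated nodes lie among the `s + 2` spine nodes of `t`, above the grafted part.
merge-graft : ∀ {k s t j} c → j ℕ.≤ s → Below k (suc (suc s)) t → merge j (graft c t) ≡ graft c (merge j t)
merge-graft {j = zero}  c _         (x ∷ y ∷ b) = refl
merge-graft {j = suc j} c (ℕ.s≤s h) (x ∷ b)     = cong (node _ _) (merge-graft c h b)

modifyAt-graft : ∀ {k s t} f c → Below k s t → modifyAt (replicate s R) f (graft c t) ≡ graft (f c) t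
modifyAt-graft f c []      = refl
modifyAt-graft f c (x ∷ b) = cong (node _ _) (modifyAt-graft f c b)

-- Merging the root pushes it and its left subtree below the new root, which lengthens the leftmost
-- path; a merge further down leaves that path alone.
leftEdges-merge : ∀ j t → leftEdges t ℕ.≤ leftEdges (merge j t)
leftEdges-merge zero    leaf                    = ℕ.z≤n
leftEdges-merge zero    (node _ _ leaf)         = ℕ.≤-refl
leftEdges-merge zero    (node _ _ (node _ _ _)) = ℕ.n≤1+n _
leftEdges-merge (suc j) leaf                    = ℕ.z≤n
leftEdges-merge (suc j) (node _ _ _)            = ℕ.≤-refl

leftEdges-merge₀ : ∀ {k s t} → Below k (suc (suc s)) t → leftEdges (merge 0 t) ≡ suc (leftEdges t)
leftEdges-merge₀ (x ∷ y ∷ b) = refl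

leftEdges-graft : ∀ c t → leftEdges t ℕ.≤ leftEdges (graft c t)
leftEdges-graft c leaf         = ℕ.z≤n
leftEdges-graft c (node _ _ _) = ℕ.≤-refl

replicate-++ : ∀ s (d : Dir) → replicate s d ++ d ∷ [] ≡ d ∷ replicate s d
replicate-++ zero    d = refl
replicate-++ (suc s) d = cong (d ∷_) (replicate-++ s d)

reverse-replicate : ∀ s (d : Dir) → reverse (replicate s d) ≡ replicate s d
reverse-replicate zero    d = refl
reverse-replicate (suc s) d = trans (unfold-reverse d (replicate s d))
  (trans (cong (_++ d ∷ []) (reverse-replicate s d)) (replicate-++ s d))

-- Insertion and rebalancing at the end of the right spine

rebalanceAt-RR : ∀ j t → rebalanceAt (replicate (suc (suc j)) R) t ≡ merge j t
rebalanceAt-RR j t = cong (λ ps → rotateUp ps R t) (reverse-replicate j R)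

-- The first rotation lifts `k` above `n` and lengthens the spine by one; the second moves the last
-- node of `t` below `k` and shortens it again. The zigzag case thus keeps the spine length.
rebalanceAt-LR : ∀ {k s t} n → Below k (suc s) t →
  rebalanceAt (L ∷ replicate (suc s) R) (graft (node (single k) n leaf) t)
    ≡ merge s (graft (node leaf k (single n)) t)
rebalanceAt-LR {k} {s} n b = trans
  (cong₂ (λ ps qs → rotateUp ps R (rotateUp qs L _)) (reverse-replicate s R) (reverse-replicate (suc s) R))
  (cong (merge s) (modifyAt-graft (rotUp L) (node (single k) n leaf) b))

insert-max : ∀ {k s t} n → k ℕ.≤ n → Below k s t →
  insert n t ≡ (graft (single n) t , replicate s R)
insert-max {s = s} {t = t} n k≤n b =
  trans (cong (insert n) (sym (graft-leaf t)))
    (trans (insert-graft k≤n b refl) (cong (graft (single n) t ,_) (++-identityʳ (replicate s R))))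

-- The subtree holding the pair (k + 1, k) at the end of the spine, before rebalancing.
twin : ℕ → Tree
twin k = node (single k) (suc k) leaf

insert-twin : ∀ {k s t} → Below k s t →
  insert k (graft (single (suc k)) t) ≡ (graft (twin k) t , replicate s R ++ L ∷ [])
insert-twin b = insert-graft ℕ.≤-refl b (insert-left (ℕ.n<1+n _) refl)

Below-twin : ∀ {k s t} → Below k s t → Below (suc (suc k)) (suc s) (graft (twin k) t)
Below-twin {k} = Below-graft (ℕ.m≤n+m k 2) (ℕ.n<1+n (suc k) ∷ [])

Below-zigzag : ∀ {k s t} → Below k s t →
  Below (suc (suc k)) (suc s) (rebalanceAt (L ∷ replicate s R) (graft (twin k) t))
-- Here the new node is a child of the root, so nothing is rotated.
Below-zigzag {s = zero} b = Below-twin b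
Below-zigzag {k} {suc s} {t} b = subst (Below (suc (suc k)) (suc (suc s))) (sym (rebalanceAt-LR (suc k) b))
  (Below-merge (ℕ.n≤1+n s) (Below-graft (ℕ.m≤n+m k 2) (ℕ.m≤n⇒m≤1+n ℕ.≤-refl ∷ ℕ.n<1+n (suc k) ∷ []) b))

leftEdges-rebalanceAt : ∀ c j t →
  leftEdges t ℕ.≤ leftEdges (rebalanceAt (replicate j R) (graft c t))
leftEdges-rebalanceAt c 0             t = leftEdges-graft c t
leftEdges-rebalanceAt c 1             t = leftEdges-graft c t
leftEdges-rebalanceAt c (suc (suc j)) t rewrite rebalanceAt-RR j (graft c t) =
  ℕ.≤-trans (leftEdges-graft c t) (leftEdges-merge j (graft c t))

leftEdges-zigzag : ∀ {k s t} → Below k s t →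
  leftEdges t ℕ.≤ leftEdges (rebalanceAt (L ∷ replicate s R) (graft (twin k) t))
leftEdges-zigzag []        = ℕ.z≤n
leftEdges-zigzag {k} {suc s} {t} b@(_ ∷ _) rewrite rebalanceAt-LR (suc k) b =
  ℕ.≤-trans (leftEdges-graft (node leaf k (single (suc k))) t) (leftEdges-merge s _)

-- The rotation lifts the parent of `v` over its grandparent, so even when `v` is the root of the
-- grafted piece both rotated nodes belong to the old spine. The piece stays intact at the end of
-- the spine.
Below-first : ∀ {k s t} c j → j ℕ.≤ s → Below k s t →
  ∃[ s′ ] ∃[ u ] (Below k s′ u × rebalanceAt (replicate j R) (graft c t) ≡ graft c u)
Below-first c 0             _                   b = _ , _ , b , refl
Below-first c 1             _                   b = _ , _ , b , refl
Below-first c (suc (suc j)) (ℕ.s≤s (ℕ.s≤s j≤s)) b =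
  _ , _ , Below-merge j≤s b , trans (rebalanceAt-RR j _) (merge-graft c j≤s b)

Below-second : ∀ {k s t} j → j ℕ.≤ s → Below k s t →
  ∃[ s′ ] Below (suc (suc k)) s′ (rebalanceAt (replicate j R) (graft (twin k) t))
Below-second {k} j j≤s b with Below-first (twin k) j j≤s b
... | _ , _ , b′ , eq = _ , subst (Below _ _) (sym eq) (Below-twin b′)

-- The smaller key of pair `m`, counted from 0. It doubles as the bound `k` in `Below` for the tree
-- before that pair.
oddKey : ℕ → ℕ
oddKey m = 2 ℕ.* suc m ℕ.∸ 1

oddKey-suc : ∀ m → oddKey (suc m) ≡ suc (suc (oddKey m))
oddKey-suc m = cong suc (ℕ.+-suc m (suc m ℕ.+ 0))

length-pairsSeq : ∀ m → length (pairsSeq m) ≡ 2 ℕ.* m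
length-pairsSeq zero    = refl
length-pairsSeq (suc m) = trans (length-++ (pairsSeq m))
  (trans (cong (ℕ._+ 2) (length-pairsSeq m)) (trans (ℕ.+-comm (2 ℕ.* m) 2) (sym (ℕ.*-suc 2 m))))

-- Rational arithmetic

open +-*-Solver using (solve; _:=_; _:+_; _:*_; _:-_; con)

0≤+ : ∀ {a b} → 0ℚ ≤ a → 0ℚ ≤ b → 0ℚ ≤ a + b
0≤+ = +-mono-≤

0≤* : ∀ {a b} → 0ℚ ≤ a → 0ℚ ≤ b → 0ℚ ≤ a * b
0≤* {a} {b} 0≤a 0≤b =
  subst (_≤ a * b) (ℚ.*-zeroʳ a) (ℚ.*-monoˡ-≤-nonNeg a {{nonNegative 0≤a}} 0≤b)

0<* : ∀ {a b} → 0ℚ < a → 0ℚ < b → 0ℚ < a * b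
0<* {a} {b} 0<a 0<b = subst (_< a * b) (ℚ.*-zeroʳ a) (ℚ.*-monoʳ-<-pos a {{positive 0<a}} 0<b)

0≤- : ∀ {a b} → a ≤ b → 0ℚ ≤ b - a
0≤- {a} {b} a≤b = subst (_≤ b - a) (ℚ.+-inverseʳ a) (ℚ.+-monoˡ-≤ (ℚ.- a) a≤b)

-- Inequalities below are proved by exhibiting a nonnegative slack e;
-- what remains is a ring identity.
slack : ∀ {a b} e → 0ℚ ≤ e → a + e ≡ b → a ≤ b
slack {a} e 0≤e refl = subst (_≤ a + e) (ℚ.+-identityʳ a) (ℚ.+-monoʳ-≤ a 0≤e)

0≤² : ∀ a → 0ℚ ≤ a * a
0≤² a with ℚ.≤-total 0ℚ a
... | inj₁ 0≤a = 0≤* 0≤a 0≤a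
... | inj₂ a≤0 = subst (0ℚ ≤_) (solve 1 (λ a → (con 0ℚ :- a) :* (con 0ℚ :- a) := a :* a) refl a)
  (0≤* (0≤- a≤0) (0≤- a≤0))

0≤½ : 0ℚ ≤ ½
0≤½ = ℚ.nonNegative⁻¹ ½

⟦_⟧ : ℕ → ℚ
⟦ n ⟧ = + n / 1

toℚᵘ-⟦⟧ : ∀ n → ℚ.toℚᵘ ⟦ n ⟧ ℚᵘ.≃ ℚᵘ.mkℚᵘ (+ n) 0
toℚᵘ-⟦⟧ n = ℚ.toℚᵘ-fromℚᵘ (ℚᵘ.mkℚᵘ (+ n) 0)

⟦⟧-+ : ∀ m n → ⟦ m ℕ.+ n ⟧ ≡ ⟦ m ⟧ + ⟦ n ⟧
⟦⟧-+ m n = ℚ.toℚᵘ-injective (begin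
  ℚ.toℚᵘ ⟦ m ℕ.+ n ⟧                        ≈⟨ toℚᵘ-⟦⟧ (m ℕ.+ n) ⟩
  ℚᵘ.mkℚᵘ (+ (m ℕ.+ n)) 0                   ≈⟨ ℚᵘ.*≡* (cong (ℤ._* + 1) (sym (cong₂ ℤ._+_ (ℤ.*-identityʳ (+ m)) (ℤ.*-identityʳ (+ n))))) ⟩
  ℚᵘ.mkℚᵘ (+ m) 0 ℚᵘ.+ ℚᵘ.mkℚᵘ (+ n) 0     ≈⟨ ℚᵘ.+-cong (toℚᵘ-⟦⟧ m) (toℚᵘ-⟦⟧ n) ⟨
  ℚ.toℚᵘ ⟦ m ⟧ ℚᵘ.+ ℚ.toℚᵘ ⟦ n ⟧            ≈⟨ ℚ.toℚᵘ-homo-+ ⟦ m ⟧ ⟦ n ⟧ ⟨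
  ℚ.toℚᵘ (⟦ m ⟧ + ⟦ n ⟧)                    ∎)
  where open ℚᵘ.≃-Reasoning

⟦⟧-* : ∀ m n → ⟦ m ℕ.* n ⟧ ≡ ⟦ m ⟧ * ⟦ n ⟧
⟦⟧-* m n = ℚ.toℚᵘ-injective (begin
  ℚ.toℚᵘ ⟦ m ℕ.* n ⟧                        ≈⟨ toℚᵘ-⟦⟧ (m ℕ.* n) ⟩
  ℚᵘ.mkℚᵘ (+ (m ℕ.* n)) 0                   ≈⟨ ℚᵘ.*≡* (cong (ℤ._* + 1) (ℤ.pos-* m n)) ⟩
  ℚᵘ.mkℚᵘ (+ m) 0 ℚᵘ.* ℚᵘ.mkℚᵘ (+ n) 0     ≈⟨ ℚᵘ.*-cong (toℚᵘ-⟦⟧ m) (toℚᵘ-⟦⟧ n) ⟨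
  ℚ.toℚᵘ ⟦ m ⟧ ℚᵘ.* ℚ.toℚᵘ ⟦ n ⟧            ≈⟨ ℚ.toℚᵘ-homo-* ⟦ m ⟧ ⟦ n ⟧ ⟨
  ℚ.toℚᵘ (⟦ m ⟧ * ⟦ n ⟧)                    ∎)
  where open ℚᵘ.≃-Reasoning

0≤⟦⟧ : ∀ n → 0ℚ ≤ ⟦ n ⟧
0≤⟦⟧ n = ℚ.nonNegative⁻¹ ⟦ n ⟧ {{ℚ.normalize-nonNeg n 1}}

⟦⟧-mono : ∀ {m n} → m ℕ.≤ n → ⟦ m ⟧ ≤ ⟦ n ⟧
⟦⟧-mono {m} {n} m≤n = slack ⟦ n ℕ.∸ m ⟧ (0≤⟦⟧ (n ℕ.∸ m))
  (trans (sym (⟦⟧-+ m (n ℕ.∸ m))) (cong ⟦_⟧ (ℕ.m+[n∸m]≡n m≤n)))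

/-⟦⟧ : ∀ a k → (+ a / suc k) * ⟦ suc k ⟧ ≡ ⟦ a ⟧
/-⟦⟧ a k = ℚ.toℚᵘ-injective (begin
  ℚ.toℚᵘ ((+ a / suc k) * ⟦ suc k ⟧)                ≈⟨ ℚ.toℚᵘ-homo-* (+ a / suc k) ⟦ suc k ⟧ ⟩
  ℚ.toℚᵘ (+ a / suc k) ℚᵘ.* ℚ.toℚᵘ ⟦ suc k ⟧        ≈⟨ ℚᵘ.*-cong (ℚ.toℚᵘ-fromℚᵘ (ℚᵘ.mkℚᵘ (+ a) k)) (toℚᵘ-⟦⟧ (suc k)) ⟩
  ℚᵘ.mkℚᵘ (+ a) k ℚᵘ.* ℚᵘ.mkℚᵘ (+ suc k) 0          ≈⟨ ℚᵘ.*≡* (ℤ.*-assoc (+ a) (+ suc k) (+ 1)) ⟩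
  ℚᵘ.mkℚᵘ (+ a) 0                                   ≈⟨ toℚᵘ-⟦⟧ a ⟨
  ℚ.toℚᵘ ⟦ a ⟧                                      ∎)
  where open ℚᵘ.≃-Reasoning

infixr 8 _^_

_^_ : ℚ → ℕ → ℚ
q ^ zero  = 1ℚ
q ^ suc n = q * q ^ n

0≤^ : ∀ {q} → 0ℚ ≤ q → ∀ n → 0ℚ ≤ q ^ n
0≤^ 0≤q zero    = 0≤⟦⟧ 1
0≤^ 0≤q (suc n) = 0≤* 0≤q (0≤^ 0≤q n)

-- Finite distributions

module _ {A : Set} where

  expect-cong : ∀ {f g : A → ℚ} → (∀ a → f a ≡ g a) → ∀ d → expect f d ≡ expect g d
  expect-cong f≗g []            = refl
  expect-cong f≗g ((q , a) ∷ d) = cong₂ (λ x y → q * x + y) (f≗g a) (expect-cong f≗g d)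

  expect-+ : ∀ (f g : A → ℚ) d → expect (λ a → f a + g a) d ≡ expect f d + expect g d
  expect-+ f g []            = refl
  expect-+ f g ((q , a) ∷ d) = trans (cong (_+_ (q * (f a + g a))) (expect-+ f g d))
    (solve 5 (λ q x y u v → q :* (x :+ y) :+ (u :+ v) := (q :* x :+ u) :+ (q :* y :+ v)) refl q (f a) (g a) _ _)

  expect-* : ∀ c (f : A → ℚ) d → expect (λ a → c * f a) d ≡ c * expect f d
  expect-* c f []            = sym (ℚ.*-zeroʳ c)
  expect-* c f ((q , a) ∷ d) = trans (cong (_+_ (q * (c * f a))) (expect-* c f d))
    (solve 4 (λ q c x u → q :* (c :* x) :+ c :* u := c :* (q :* x :+ u)) refl q c (f a) _)

  expect-++ : ∀ (f : A → ℚ) d e → expect f (d ++ e) ≡ expect f d + expect f e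
  expect-++ f []            e = sym (ℚ.+-identityˡ _)
  expect-++ f ((q , a) ∷ d) e = trans (cong (_+_ (q * f a)) (expect-++ f d e)) (sym (ℚ.+-assoc (q * f a) _ _))

  expect-scale : ∀ (f : A → ℚ) c d → expect f (scale c d) ≡ c * expect f d
  expect-scale f c []            = sym (ℚ.*-zeroʳ c)
  expect-scale f c ((q , a) ∷ d) = trans (cong (_+_ (c * q * f a)) (expect-scale f c d))
    (solve 4 (λ q c x u → c :* q :* x :+ c :* u := c :* (q :* x :+ u)) refl q c (f a) _)

  expect-return : ∀ (f : A → ℚ) a → expect f (return a) ≡ f a
  expect-return f a = trans (ℚ.+-identityʳ _) (ℚ.*-identityˡ (f a))

expect-bind : ∀ {A B : Set} (f : B → ℚ) (d : Dist A) (k : A → Dist B) →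
  expect f (bind d k) ≡ expect (λ a → expect f (k a)) d
expect-bind f []            k = refl
expect-bind f ((q , a) ∷ d) k = trans (expect-++ f (scale q (k a)) (bind d k))
  (cong₂ _+_ (expect-scale f q (k a)) (expect-bind f d k))

-- P holds on the support and the weights are nonnegative, phrased through expectations:
-- this form composes along bind without looking at the lists.
Surely : ∀ {A : Set} → (A → Set) → Dist A → Set
Surely {A} P d = ∀ (f g : A → ℚ) → (∀ a → P a → f a ≤ g a) → expect f d ≤ expect g d

Surely-bind : ∀ {A B : Set} (P : A → Set) (Q : B → Set) (d : Dist A) (k : A → Dist B) →
  Surely P d → (∀ a → P a → Surely Q (k a)) → Surely Q (bind d k)
Surely-bind P Q d k hd hk f g f≤g = begin
  expect f (bind d k)              ≡⟨ expect-bind f d k ⟩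
  expect (λ a → expect f (k a)) d  ≤⟨ hd _ _ (λ a Pa → hk a Pa f g f≤g) ⟩
  expect (λ a → expect g (k a)) d  ≡⟨ expect-bind g d k ⟨
  expect g (bind d k)              ∎
  where open ℚ.≤-Reasoning

Surely-return : ∀ {A : Set} {P : A → Set} {a} → P a → Surely P (return a)
Surely-return {a = a} Pa f g f≤g = begin
  expect f (return a)  ≡⟨ expect-return f a ⟩
  f a                  ≤⟨ f≤g a Pa ⟩
  g a                  ≡⟨ expect-return g a ⟨
  expect g (return a)  ∎
  where open ℚ.≤-Reasoning

-- The random walk

-- Recursion on the path replaces the weighted list, so that means can be compared one coin flip at
-- a time.
walkMean : ℚ → (List Dir → ℚ) → List Dir → ℚ
walkMean p f []       = f []
walkMean p f (d ∷ ds) = p * walkMean p f ds + (1ℚ - p) * f (d ∷ ds)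

expect-walk : ∀ p f ds → expect f (walk p ds) ≡ walkMean p f ds
expect-walk p f []       = expect-return f []
expect-walk p f (d ∷ ds) = trans
  (expect-++ f (scale p (walk p ds)) _)
  (cong₂ _+_
    (trans (expect-scale f p (walk p ds)) (cong (p *_) (expect-walk p f ds)))
    (trans (expect-scale f (1ℚ - p) (return (d ∷ ds))) (cong ((1ℚ - p) *_) (expect-return f (d ∷ ds)))))

expect-insertStep : ∀ p f k t {t′ path} → insert k t ≡ (t′ , path) →
  expect f (insertStep p k t) ≡ walkMean p (λ v → f (rebalanceAt v t′)) (reverse path)
expect-insertStep p f k t {t′} {path} eq rewrite eq = trans
  (expect-bind f (walk p (reverse path)) (λ v → return (rebalanceAt v t′)))
  (trans (expect-cong (λ v → expect-return f (rebalanceAt v t′)) (walk p (reverse path)))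
         (expect-walk p _ (reverse path)))

walkMean-const : ∀ p c ds → walkMean p (λ _ → c) ds ≡ c
walkMean-const p c []       = refl
walkMean-const p c (d ∷ ds) = trans (cong (λ w → p * w + (1ℚ - p) * c) (walkMean-const p c ds))
  (solve 2 (λ p c → p :* c :+ (con 1ℚ :- p) :* c := c) refl p c)

walkMean-one : ∀ {p} → p ≡ 1ℚ → ∀ f ds → walkMean p f ds ≡ f []
walkMean-one refl f []       = refl
walkMean-one refl f (d ∷ ds) = trans (cong (λ w → 1ℚ * w + 0ℚ * f (d ∷ ds)) (walkMean-one refl f ds))
  (solve 2 (λ x y → con 1ℚ :* x :+ con 0ℚ :* y := x) refl (f []) (f (d ∷ ds)))

-- The suffixes of a reversed path are the positions where the walk can stop.
Suffixes : (List Dir → Set) → List Dir → Set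
Suffixes P []       = P []
Suffixes P (d ∷ ds) = P (d ∷ ds) × Suffixes P ds

suffixes : ∀ {P} → (∀ v → P v) → ∀ ds → Suffixes P ds
suffixes h []       = h []
suffixes h (d ∷ ds) = h (d ∷ ds) , suffixes h ds

suffixes-R : ∀ {P} s → (∀ j → j ℕ.≤ s → P (replicate j R)) → Suffixes P (replicate s R)
suffixes-R zero    h = h 0 ℕ.z≤n
suffixes-R (suc s) h = h (suc s) ℕ.≤-refl , suffixes-R s (λ j j≤s → h j (ℕ.m≤n⇒m≤1+n j≤s))

-- Drift of the spine statistics

-- The truncation is deliberate: while the first pairs lengthen the spine to 0, 1, 2 nodes the
-- excess stays 0, so the drift bounds hold from the empty tree on.
excess : Tree → ℕ
excess t = rightSpine t ℕ.∸ 2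

excess-Below : ∀ {k s t} → Below k s t → ⟦ excess t ⟧ ≡ ⟦ s ℕ.∸ 2 ⟧
excess-Below b = cong (λ s → ⟦ s ℕ.∸ 2 ⟧) (Below-rightSpine b)

module _ (p : ℚ) (0≤p : 0ℚ ≤ p) (p≤1 : p ≤ 1ℚ) where

  private
    0≤1-p : 0ℚ ≤ 1ℚ - p
    0≤1-p = 0≤- p≤1

    mix-≤ : ∀ {a b c d} → a ≤ c → b ≤ d → p * a + (1ℚ - p) * b ≤ p * c + (1ℚ - p) * d
    mix-≤ a≤c b≤d = +-mono-≤ (ℚ.*-monoˡ-≤-nonNeg p {{nonNegative 0≤p}} a≤c)
                             (ℚ.*-monoˡ-≤-nonNeg (1ℚ - p) {{nonNegative 0≤1-p}} b≤d)

  walkMean-mono : ∀ {f g} ds → Suffixes (λ v → f v ≤ g v) ds → walkMean p f ds ≤ walkMean p g ds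
  walkMean-mono []       h        = h
  walkMean-mono (d ∷ ds) (h , hs) = mix-≤ (walkMean-mono ds hs) h

  walkMean-≥ : ∀ f {a} ds → Suffixes (λ v → a ≤ f v) ds → a ≤ walkMean p f ds
  walkMean-≥ f {a} ds h = subst (_≤ _) (walkMean-const p a ds) (walkMean-mono ds h)

  -- From depth `s + 1` it takes `s` tails, of probability `p ^ s`, to get to depth at most 1; only
  -- there may `f` exceed `a`, and by at most 1.
  walkMean-R-upper : ∀ {f a} s → f [] ≤ a + 1ℚ → f (R ∷ []) ≤ a + 1ℚ →
    (∀ j → j ℕ.< s → f (replicate (suc (suc j)) R) ≤ a) →
    walkMean p f (replicate (suc s) R) ≤ a + p ^ s
  walkMean-R-upper {a = a} zero h₀ h₁ h = ≤-trans (mix-≤ h₀ h₁)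
    (≤-reflexive (solve 2 (λ p a → p :* a :+ (con 1ℚ :- p) :* a := a) refl p (a + 1ℚ)))
  walkMean-R-upper {a = a} (suc s) h₀ h₁ h = ≤-trans
    (mix-≤ (walkMean-R-upper s h₀ h₁ (λ j j<s → h j (ℕ.m<n⇒m<1+n j<s))) (h s (ℕ.n<1+n s)))
    (≤-reflexive (solve 3 (λ p a y → p :* (a :+ y) :+ (con 1ℚ :- p) :* a := a :+ p :* y) refl p a (p ^ s)))

  -- From depth `i + 2` the walk stops exactly at depth 2 after `i` tails and a head; the extra 1 is
  -- collected there.
  walkMean-R-lower : ∀ f {a} i → (∀ j → j ℕ.≤ suc (suc i) → a ≤ f (replicate j R)) →
    a + 1ℚ ≤ f (R ∷ R ∷ []) →
    a + (1ℚ - p) * p ^ i ≤ walkMean p f (replicate (suc (suc i)) R)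
  walkMean-R-lower f {a} zero h h₂ = ≤-trans
    (≤-reflexive (solve 2 (λ p a → a :+ (con 1ℚ :- p) :* con 1ℚ := p :* a :+ (con 1ℚ :- p) :* (a :+ con 1ℚ)) refl p a))
    (mix-≤ (walkMean-≥ f (R ∷ []) (h 1 (ℕ.s≤s ℕ.z≤n) , h 0 ℕ.z≤n)) h₂)
  walkMean-R-lower f {a} (suc i) h h₂ = ≤-trans
    (≤-reflexive (solve 3 (λ p a y → a :+ (con 1ℚ :- p) :* (p :* y) := p :* (a :+ (con 1ℚ :- p) :* y) :+ (con 1ℚ :- p) :* a)
      refl p a (p ^ i)))
    (mix-≤ (walkMean-R-lower f i (λ j j≤ → h j (ℕ.m≤n⇒m≤1+n j≤)) h₂) (h (suc (suc (suc i))) ℕ.≤-refl))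

  stepMean : (Tree → ℚ) → ℕ → Tree → ℚ
  stepMean f k t = expect f (insertStep p k t)

  second-≡ : ∀ f {k s t} → Below k s t → stepMean f k (graft (single (suc k)) t) ≡
    walkMean p (λ v → f (rebalanceAt v (graft (twin k) t))) (L ∷ replicate s R)
  second-≡ f {k} {s} {t} b = trans (expect-insertStep p f k (graft (single (suc k)) t) (insert-twin b))
    (cong (walkMean p _) (trans (reverse-++ (replicate s R) (L ∷ [])) (cong (L ∷_) (reverse-replicate s R))))

  first-≡ : ∀ f {k s t} → Below k s t → expect f (insertStep p (suc k) t) ≡
    walkMean p (λ v → f (rebalanceAt v (graft (single (suc k)) t))) (replicate s R)
  first-≡ f {k} {s} {t} b = trans (expect-insertStep p f (suc k) t (insert-max (suc k) (ℕ.n≤1+n k) b))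
    (cong (walkMean p _) (reverse-replicate s R))

  -- Before key `k` arrives the excess is `s ∸ 1`. Stopping at `k` itself keeps it; after a tail, a
  -- merge lowers the spine by one unless the walk gets to depth at most 1. Such a merge has
  -- probability `p - p ^ suc (s ∸ 1)`.
  second-excess : ∀ {k s t} → Below k s t →
    stepMean (λ u → ⟦ excess u ⟧) k (graft (single (suc k)) t) ≤ ⟦ s ℕ.∸ 1 ⟧ + p ^ suc (s ℕ.∸ 1) - p
  second-excess b@[] = ≤-reflexive (trans (second-≡ (λ u → ⟦ excess u ⟧) b)
    (solve 1 (λ p → p :* con 0ℚ :+ (con 1ℚ :- p) :* con 0ℚ := con 0ℚ :+ p :* con 1ℚ :- p) refl p))
  second-excess b@(_ ∷ []) = ≤-reflexive (trans (second-≡ (λ u → ⟦ excess u ⟧) b)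
    (solve 1 (λ p → p :* (p :* con 0ℚ :+ (con 1ℚ :- p) :* con 0ℚ) :+ (con 1ℚ :- p) :* con 0ℚ
      := con 0ℚ :+ p :* con 1ℚ :- p) refl p))
  second-excess {k} {suc (suc i)} {t} b@(_ ∷ _ ∷ _) = ≤-trans (≤-reflexive (second-≡ (λ u → ⟦ excess u ⟧) b))
    (≤-trans (mix-≤ (walkMean-R-upper (suc i) stay stay up) (≤-reflexive (excess-Below (Below-zigzag b))))
    (≤-reflexive (trans (cong (λ n → p * (⟦ i ⟧ + p ^ suc i) + (1ℚ - p) * n) (⟦⟧-+ 1 i))
      (trans (solve 3 (λ p i y → p :* (i :+ y) :+ (con 1ℚ :- p) :* (con 1ℚ :+ i) := con 1ℚ :+ i :+ p :* y :- p) refl p ⟦ i ⟧ (p ^ suc i))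
        (cong (λ n → n + p ^ suc (suc i) - p) (sym (⟦⟧-+ 1 i)))))))
    where
    stay : ⟦ excess (graft (twin k) t) ⟧ ≤ ⟦ i ⟧ + 1ℚ
    stay = ≤-reflexive (trans (excess-Below (Below-twin b)) (trans (⟦⟧-+ 1 i) (ℚ.+-comm 1ℚ ⟦ i ⟧)))
    up : ∀ j → j ℕ.< suc i → ⟦ excess (rebalanceAt (replicate (suc (suc j)) R) (graft (twin k) t)) ⟧ ≤ ⟦ i ⟧
    up j j<1+i = ≤-reflexive (trans (cong (λ u → ⟦ excess u ⟧) (rebalanceAt-RR j _))
      (excess-Below (Below-merge (ℕ.<⇒≤ j<1+i) (Below-twin b))))

  pairMean : (Tree → ℚ) → ℕ → Tree → ℚ
  pairMean f k t = expect (stepMean f k) (insertStep p (suc k) t)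

  -- For `s = i + 2`, a merge by the first key leads to the bound `i + p ^ (i + 1) - p` after the
  -- second. The first key fails to merge with probability `p ^ (i + 1)`, which adds at most that
  -- much again.
  excess-drift : ∀ {k s t} → Below k s t →
    pairMean (λ u → ⟦ excess u ⟧) k t ≤ ⟦ excess t ⟧ + p * (p ^ excess t + p ^ excess t - 1ℚ)
  -- With at most one spine node the excess is 0 before and after the pair, while the bound equals
  -- `p`.
  excess-drift {k} b@[] = ≤-trans (≤-reflexive (first-≡ (stepMean (λ u → ⟦ excess u ⟧) k) b)) (≤-trans (second-excess b)
    (slack p 0≤p (solve 1 (λ p → con 0ℚ :+ p :* con 1ℚ :- p :+ p := con 0ℚ :+ p :* (con 1ℚ :+ con 1ℚ :- con 1ℚ)) refl p)))
  excess-drift {k} b@(_ ∷ []) = ≤-trans (≤-reflexive (first-≡ (stepMean (λ u → ⟦ excess u ⟧) k) b))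
    (≤-trans (mix-≤ (second-excess b) (second-excess b))
    (slack p 0≤p (solve 1 (λ p → let h = con 0ℚ :+ p :* con 1ℚ :- p in p :* h :+ (con 1ℚ :- p) :* h :+ p
      := con 0ℚ :+ p :* (con 1ℚ :+ con 1ℚ :- con 1ℚ)) refl p)))
  excess-drift {k} {suc (suc i)} {t} b@(_ ∷ _ ∷ b′) rewrite Below-rightSpine b′ =
    ≤-trans (≤-reflexive (first-≡ (stepMean (λ u → ⟦ excess u ⟧) k) b))
    (≤-trans (walkMean-R-upper (suc i) stay stay up)
    (≤-reflexive (solve 3 (λ p i y → i :+ p :* y :- p :+ p :* y := i :+ p :* (y :+ y :- con 1ℚ)) refl p ⟦ i ⟧ (p ^ i))))
    where
    f : Tree → ℚ
    f = stepMean (λ u → ⟦ excess u ⟧) k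
    stay : f (graft (single (suc k)) t) ≤ ⟦ i ⟧ + p ^ suc i - p + 1ℚ
    -- The bounds of `second-excess` for the unmerged and the merged spine differ by
    -- `1 - (1 - p) p ^ (i + 1)`, hence by at most 1.
    stay = ≤-trans (second-excess b) (slack ((1ℚ - p) * p ^ suc i) (0≤* 0≤1-p (0≤^ 0≤p (suc i)))
      (trans (cong (λ n → n + p ^ suc (suc i) - p + (1ℚ - p) * p ^ suc i) (⟦⟧-+ 1 i))
        (solve 3 (λ p i y → con 1ℚ :+ i :+ p :* y :- p :+ (con 1ℚ :- p) :* y := i :+ y :- p :+ con 1ℚ) refl p ⟦ i ⟧ (p ^ suc i))))
    up : ∀ j → j ℕ.< suc i → f (rebalanceAt (replicate (suc (suc j)) R) (graft (single (suc k)) t)) ≤ ⟦ i ⟧ + p ^ suc i - p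
    up j (ℕ.s≤s j≤i) = ≤-trans
      (≤-reflexive (cong f (trans (rebalanceAt-RR j _) (merge-graft (single (suc k)) j≤i b))))
      (second-excess (Below-merge j≤i b))

  second-leftEdges : ∀ {k s t} → Below k s t →
    ⟦ leftEdges t ⟧ ≤ stepMean (λ u → ⟦ leftEdges u ⟧) k (graft (single (suc k)) t)
  second-leftEdges {k} {s} {t} b = ≤-trans
    (walkMean-≥ (λ v → ⟦ leftEdges (rebalanceAt v (graft (twin k) t)) ⟧) (L ∷ replicate s R) (⟦⟧-mono (leftEdges-zigzag b) ,
      suffixes-R s (λ j _ → ⟦⟧-mono (leftEdges-rebalanceAt (twin k) j t))))
    (≤-reflexive (sym (second-≡ (λ u → ⟦ leftEdges u ⟧) b)))

  -- On so short a spine, stopping at `k` gains an edge: `k` is the left child of the root, or the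
  -- zigzag puts the old root to the left of `k`. The factor `1ℚ` is `p ^ 0`, the form in which
  -- `leftEdges-drift` asks for it.
  second-leftEdges⁺ : ∀ {k s t} → s ℕ.≤ 1 → Below k s t →
    ⟦ leftEdges t ⟧ + (1ℚ - p) * 1ℚ ≤ stepMean (λ u → ⟦ leftEdges u ⟧) k (graft (single (suc k)) t)
  second-leftEdges⁺ _ b@[] = ≤-trans
    (slack p 0≤p (solve 1 (λ p → con 0ℚ :+ (con 1ℚ :- p) :* con 1ℚ :+ p
      := p :* con 1ℚ :+ (con 1ℚ :- p) :* con 1ℚ) refl p))
    (≤-reflexive (sym (second-≡ (λ u → ⟦ leftEdges u ⟧) b)))
  second-leftEdges⁺ {t = t} _ b@(_ ∷ []) = ≤-reflexive (trans
    (trans (solve 2 (λ p a → a :+ (con 1ℚ :- p) :* con 1ℚ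
             := p :* (p :* a :+ (con 1ℚ :- p) :* a) :+ (con 1ℚ :- p) :* (con 1ℚ :+ a)) refl p a)
           (cong (λ n → p * (p * a + (1ℚ - p) * a) + (1ℚ - p) * n) (sym (⟦⟧-+ 1 (leftEdges t)))))
    (sym (second-≡ (λ u → ⟦ leftEdges u ⟧) b)))
    where
    a = ⟦ leftEdges t ⟧
  second-leftEdges⁺ (ℕ.s≤s ()) (_ ∷ _ ∷ _)

  -- From two spine nodes on, the first key alone gives the gain, by merging the root when its walk
  -- stops at depth 2; the second key cannot undo it. On shorter spines the second key gives the
  -- gain.
  leftEdges-drift : ∀ {k s t} → Below k s t →
    ⟦ leftEdges t ⟧ + (1ℚ - p) * p ^ excess t ≤ pairMean (λ u → ⟦ leftEdges u ⟧) k t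
  leftEdges-drift {k} b@[] = ≤-trans (second-leftEdges⁺ ℕ.z≤n b) (≤-reflexive (sym (first-≡ (stepMean (λ u → ⟦ leftEdges u ⟧) k) b)))
  leftEdges-drift {k} {t = t} b@(_ ∷ []) = ≤-trans
    (walkMean-≥ (λ v → stepMean (λ u → ⟦ leftEdges u ⟧) k (rebalanceAt v (graft (single (suc k)) t))) (R ∷ []) (second-leftEdges⁺ ℕ.≤-refl b , second-leftEdges⁺ ℕ.≤-refl b))
    (≤-reflexive (sym (first-≡ (stepMean (λ u → ⟦ leftEdges u ⟧) k) b)))
  leftEdges-drift {k} {suc (suc i)} {t} b@(_ ∷ _ ∷ b′) rewrite Below-rightSpine b′ = ≤-trans
    (walkMean-R-lower (λ v → f (rebalanceAt v (graft (single (suc k)) t))) i stay up)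
    (≤-reflexive (sym (first-≡ (stepMean (λ u → ⟦ leftEdges u ⟧) k) b)))
    where
    f : Tree → ℚ
    f = stepMean (λ u → ⟦ leftEdges u ⟧) k
    merged : ∀ j → j ℕ.≤ i →
      ⟦ leftEdges (merge j t) ⟧ ≤ f (rebalanceAt (replicate (suc (suc j)) R) (graft (single (suc k)) t))
    merged j j≤i = ≤-trans (second-leftEdges (Below-merge j≤i b))
      (≤-reflexive (cong f (sym (trans (rebalanceAt-RR j _) (merge-graft (single (suc k)) j≤i b)))))
    stay : ∀ j → j ℕ.≤ suc (suc i) → ⟦ leftEdges t ⟧ ≤ f (rebalanceAt (replicate j R) (graft (single (suc k)) t))
    stay 0             _                   = second-leftEdges b
    stay 1             _                   = second-leftEdges b
    stay (suc (suc j)) (ℕ.s≤s (ℕ.s≤s j≤i)) = ≤-trans (⟦⟧-mono (leftEdges-merge j t)) (merged j j≤i)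
    up : ⟦ leftEdges t ⟧ + 1ℚ ≤ f (rebalanceAt (R ∷ R ∷ []) (graft (single (suc k)) t))
    up = ≤-trans (≤-reflexive (trans (sym (⟦⟧-+ (leftEdges t) 1))
        (cong ⟦_⟧ (trans (ℕ.+-comm (leftEdges t) 1) (sym (leftEdges-merge₀ b)))))) (merged 0 ℕ.z≤n)

  -- Support and composition of the insertion process

  Surely-insertStep : ∀ (P : Tree → Set) k t {t′ path} → insert k t ≡ (t′ , path) →
    Suffixes (λ v → P (rebalanceAt v t′)) (reverse path) → Surely P (insertStep p k t)
  Surely-insertStep P k t {t′} {path} eq h f g f≤g = begin
    expect f (insertStep p k t) ≡⟨ expect-insertStep p f k t eq ⟩
    walkMean p (λ v → f (rebalanceAt v t′)) (reverse path) ≤⟨ walkMean-mono (reverse path) (apply (reverse path) h) ⟩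
    walkMean p (λ v → g (rebalanceAt v t′)) (reverse path) ≡⟨ expect-insertStep p g k t eq ⟨
    expect g (insertStep p k t) ∎
    where
    open ℚ.≤-Reasoning
    apply : ∀ ds → Suffixes (λ v → P (rebalanceAt v t′)) ds →
      Suffixes (λ v → f (rebalanceAt v t′) ≤ g (rebalanceAt v t′)) ds
    apply []       h        = f≤g _ h
    apply (d ∷ ds) (h , hs) = f≤g _ h , apply ds hs

  expect-insertStep-const : ∀ c k t → expect (λ _ → c) (insertStep p k t) ≡ c
  expect-insertStep-const c k t = trans (expect-insertStep p (λ _ → c) k t refl)
    (walkMean-const p c (reverse (proj₂ (insert k t))))

  expect-insertAll-const : ∀ c ks t → expect (λ _ → c) (insertAll p ks t) ≡ c
  expect-insertAll-const c []       t = expect-return (λ _ → c) t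
  expect-insertAll-const c (k ∷ ks) t = trans (expect-bind _ (insertStep p k t) (insertAll p ks))
    (trans (expect-cong (expect-insertAll-const c ks) (insertStep p k t)) (expect-insertStep-const c k t))

  expect-insertAll-++ : ∀ f ks ls t →
    expect f (insertAll p (ks ++ ls) t) ≡ expect (λ u → expect f (insertAll p ls u)) (insertAll p ks t)
  expect-insertAll-++ f []       ls t = sym (expect-return (λ u → expect f (insertAll p ls u)) t)
  expect-insertAll-++ f (k ∷ ks) ls t = begin
    expect f (insertAll p (k ∷ ks ++ ls) t)
      ≡⟨ expect-bind f (insertStep p k t) (insertAll p (ks ++ ls)) ⟩
    expect (λ u → expect f (insertAll p (ks ++ ls) u)) (insertStep p k t)
      ≡⟨ expect-cong (expect-insertAll-++ f ks ls) (insertStep p k t) ⟩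
    expect (λ u → expect (λ w → expect f (insertAll p ls w)) (insertAll p ks u)) (insertStep p k t)
      ≡⟨ expect-bind _ (insertStep p k t) (insertAll p ks) ⟨
    expect (λ u → expect f (insertAll p ls u)) (insertAll p (k ∷ ks) t) ∎
    where open ≡-Reasoning

  size-insertAll : ∀ ks t → Surely (λ u → size u ℕ.≤ size t ℕ.+ length ks) (insertAll p ks t)
  size-insertAll []       t = Surely-return (ℕ.≤-reflexive (sym (ℕ.+-identityʳ (size t))))
  size-insertAll (k ∷ ks) t = Surely-bind (λ u → size u ℕ.≤ suc (size t)) _ (insertStep p k t) (insertAll p ks)
    (Surely-insertStep _ k t refl
      (suffixes (λ v → ℕ.≤-trans (ℕ.≤-reflexive (size-rebalanceAt v _)) (size-insert k t)) (reverse (proj₂ (insert k t)))))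
    (λ u u≤ f g f≤g → size-insertAll ks u f g (λ w w≤ → f≤g w (ℕ.≤-trans w≤
      (ℕ.≤-trans (ℕ.+-monoˡ-≤ (length ks) u≤) (ℕ.≤-reflexive (sym (ℕ.+-suc (size t) (length ks))))))))

  -- One pair turns a spine below `k` into a spine below `k + 2`; this is the induction step of
  -- `Surely-Below`.
  pairMean-mono : ∀ {k s t} f g → Below k s t →
    (∀ u → ∃[ s′ ] Below (suc (suc k)) s′ u → f u ≤ g u) → pairMean f k t ≤ pairMean g k t
  pairMean-mono {k} {s} {t} f g b f≤g = begin
    pairMean f k t
      ≡⟨ first-≡ (stepMean f k) b ⟩
    walkMean p (λ v → stepMean f k (rebalanceAt v (graft (single (suc k)) t))) (replicate s R)
      ≤⟨ walkMean-mono (replicate s R) (suffixes-R s after-first) ⟩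
    walkMean p (λ v → stepMean g k (rebalanceAt v (graft (single (suc k)) t))) (replicate s R)
      ≡⟨ first-≡ (stepMean g k) b ⟨
    pairMean g k t ∎
    where
    open ℚ.≤-Reasoning
    stepMean-mono : ∀ {s u} → Below k s u →
      stepMean f k (graft (single (suc k)) u) ≤ stepMean g k (graft (single (suc k)) u)
    stepMean-mono {s} {u} b = begin
      stepMean f k (graft (single (suc k)) u)
        ≡⟨ second-≡ f b ⟩
      walkMean p (λ v → f (rebalanceAt v (graft (twin k) u))) (L ∷ replicate s R)
        ≤⟨ walkMean-mono (L ∷ replicate s R) (f≤g _ (_ , Below-zigzag b) ,
             suffixes-R s (λ j j≤s → f≤g _ (Below-second j j≤s b))) ⟩
      walkMean p (λ v → g (rebalanceAt v (graft (twin k) u))) (L ∷ replicate s R)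
        ≡⟨ second-≡ g b ⟨
      stepMean g k (graft (single (suc k)) u) ∎
    after-first : ∀ j → j ℕ.≤ s →
      stepMean f k (rebalanceAt (replicate j R) (graft (single (suc k)) t))
        ≤ stepMean g k (rebalanceAt (replicate j R) (graft (single (suc k)) t))
    after-first j j≤s with Below-first (single (suc k)) j j≤s b
    ... | _ , _ , b′ , eq rewrite eq = stepMean-mono b′

  -- Expectations after `m` pairs

  pairsMean : (Tree → ℚ) → ℕ → ℚ
  pairsMean f m = expect f (insertAll p (pairsSeq m) leaf)

  -- Conditioning on the tree before the last pair, which `pairsSeq` appends at the end.
  pairsMean-suc : ∀ f m → pairsMean f (suc m) ≡ pairsMean (pairMean f (oddKey m)) m
  pairsMean-suc f m = trans
    (expect-insertAll-++ f (pairsSeq m) (suc k ∷ k ∷ []) leaf)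
    (expect-cong (λ t → trans (expect-bind f (insertStep p (suc k) t) (insertAll p (k ∷ [])))
      (expect-cong (λ u → trans (expect-bind f (insertStep p k u) return)
        (expect-cong (expect-return f) (insertStep p k u))) (insertStep p (suc k) t)))
      (insertAll p (pairsSeq m) leaf))
    where
    k : ℕ
    k = oddKey m

  Surely-Below : ∀ m → Surely (λ t → ∃[ s ] Below (oddKey m) s t) (insertAll p (pairsSeq m) leaf)
  Surely-Below zero    = Surely-return (0 , [])
  Surely-Below (suc m) f g f≤g = begin
    pairsMean f (suc m)                    ≡⟨ pairsMean-suc f m ⟩
    pairsMean (pairMean f (oddKey m)) m    ≤⟨ Surely-Below m _ _ (λ t (s , b) → pairMean-mono f g b
                                                (subst (λ k → ∀ u → ∃[ s′ ] Below k s′ u → f u ≤ g u) (oddKey-suc m) f≤g)) ⟩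
    pairsMean (pairMean g (oddKey m)) m    ≡⟨ pairsMean-suc g m ⟨
    pairsMean g (suc m)                    ∎
    where open ℚ.≤-Reasoning

  pairsMean-mono : ∀ f g m → (∀ t → f t ≤ g t) → pairsMean f m ≤ pairsMean g m
  pairsMean-mono f g m f≤g = Surely-Below m f g (λ t _ → f≤g t)

  pairsMean-+ : ∀ f g m → pairsMean (λ t → f t + g t) m ≡ pairsMean f m + pairsMean g m
  pairsMean-+ f g m = expect-+ f g (insertAll p (pairsSeq m) leaf)

  pairsMean-* : ∀ c f m → pairsMean (λ t → c * f t) m ≡ c * pairsMean f m
  pairsMean-* c f m = expect-* c f (insertAll p (pairsSeq m) leaf)

  pairsMean-const : ∀ c m → pairsMean (λ _ → c) m ≡ c
  pairsMean-const c m = expect-insertAll-const c (pairsSeq m) leaf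

  -- `meanDecay` is the unknown quantity that `potential` eliminates.
  meanExcess meanLeftEdges meanDecay : ℕ → ℚ
  meanExcess    = pairsMean (λ t → ⟦ excess t ⟧)
  meanLeftEdges = pairsMean (λ t → ⟦ leftEdges t ⟧)
  meanDecay     = pairsMean (λ t → p ^ excess t)

  meanExcess-suc : ∀ m → meanExcess (suc m) ≤ meanExcess m + p * (meanDecay m + meanDecay m - 1ℚ)
  meanExcess-suc m = begin
    meanExcess (suc m)
      ≡⟨ pairsMean-suc (λ t → ⟦ excess t ⟧) m ⟩
    pairsMean (pairMean (λ t → ⟦ excess t ⟧) (oddKey m)) m
      ≤⟨ Surely-Below m _ _ (λ t (s , b) → excess-drift b) ⟩
    pairsMean (λ t → ⟦ excess t ⟧ + p * (y t + y t - 1ℚ)) m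
      ≡⟨ pairsMean-+ (λ t → ⟦ excess t ⟧) (λ t → p * (y t + y t - 1ℚ)) m ⟩
    meanExcess m + pairsMean (λ t → p * (y t + y t - 1ℚ)) m
      ≡⟨ cong (_+_ (meanExcess m)) (trans (pairsMean-* p (λ t → y t + y t - 1ℚ) m) (cong (p *_)
           (trans (pairsMean-+ (λ t → y t + y t) (λ _ → ℚ.- 1ℚ) m)
             (cong₂ _+_ (pairsMean-+ y y m) (pairsMean-const (ℚ.- 1ℚ) m))))) ⟩
    meanExcess m + p * (meanDecay m + meanDecay m - 1ℚ) ∎
    where
    open ℚ.≤-Reasoning
    y : Tree → ℚ
    y t = p ^ excess t

  meanLeftEdges-suc : ∀ m → meanLeftEdges m + (1ℚ - p) * meanDecay m ≤ meanLeftEdges (suc m)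
  meanLeftEdges-suc m = begin
    meanLeftEdges m + (1ℚ - p) * meanDecay m
      ≡⟨ cong (_+_ (meanLeftEdges m)) (pairsMean-* (1ℚ - p) (λ t → p ^ excess t) m) ⟨
    meanLeftEdges m + pairsMean (λ t → (1ℚ - p) * p ^ excess t) m
      ≡⟨ pairsMean-+ (λ t → ⟦ leftEdges t ⟧) (λ t → (1ℚ - p) * p ^ excess t) m ⟨
    pairsMean (λ t → ⟦ leftEdges t ⟧ + (1ℚ - p) * p ^ excess t) m
      ≤⟨ Surely-Below m _ _ (λ t (s , b) → leftEdges-drift b) ⟩
    pairsMean (pairMean (λ t → ⟦ leftEdges t ⟧) (oddKey m)) m
      ≡⟨ pairsMean-suc (λ t → ⟦ leftEdges t ⟧) m ⟨
    meanLeftEdges (suc m) ∎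
    where open ℚ.≤-Reasoning

  -- Linear growth of the leftmost path and of the right spine

  0≤pairsMean : ∀ (X : Tree → ℕ) m → 0ℚ ≤ pairsMean (λ t → ⟦ X t ⟧) m
  0≤pairsMean X m = subst (_≤ pairsMean (λ t → ⟦ X t ⟧) m) (pairsMean-const 0ℚ m)
    (pairsMean-mono (λ _ → 0ℚ) (λ t → ⟦ X t ⟧) m (λ t → 0≤⟦⟧ (X t)))

  -- Weights `1 - p` on the excess drift and `2 p` on the drift of the leftmost path give
  -- `meanDecay` the coefficient `2 p (1 - p)` on both sides, where it cancels.
  potential : ∀ m → (1ℚ - p) * meanExcess m + p * (1ℚ - p) * ⟦ m ⟧ ≤ p * (meanLeftEdges m + meanLeftEdges m)
  potential zero    = ≤-reflexive (solve 1 (λ p →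
    (con 1ℚ :- p) :* con 0ℚ :+ p :* (con 1ℚ :- p) :* con 0ℚ := p :* (con 0ℚ :+ con 0ℚ)) refl p)
  potential (suc m) = slack _
    (0≤+ (0≤+ (0≤* 0≤1-p (0≤- (meanExcess-suc m)))
              (0≤* (0≤+ 0≤p 0≤p) (0≤- (meanLeftEdges-suc m))))
         (0≤- (potential m)))
    (trans (cong (λ n → (1ℚ - p) * g′ + p * (1ℚ - p) * n + e) (⟦⟧-+ 1 m))
      (solve 7 (λ p g g′ l l′ y m →
        (con 1ℚ :- p) :* g′ :+ p :* (con 1ℚ :- p) :* (con 1ℚ :+ m)
          :+ ((con 1ℚ :- p) :* (g :+ p :* (y :+ y :- con 1ℚ) :- g′)
              :+ (p :+ p) :* (l′ :- (l :+ (con 1ℚ :- p) :* y))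
              :+ (p :* (l :+ l) :- ((con 1ℚ :- p) :* g :+ p :* (con 1ℚ :- p) :* m)))
          := p :* (l′ :+ l′)) refl p g g′ l l′ y ⟦ m ⟧))
    where
    g g′ l l′ y e : ℚ
    g  = meanExcess m
    g′ = meanExcess (suc m)
    l  = meanLeftEdges m
    l′ = meanLeftEdges (suc m)
    y  = meanDecay m
    e  = (1ℚ - p) * (g + p * (y + y - 1ℚ) - g′) + (p + p) * (l′ - (l + (1ℚ - p) * y))
         + (p * (l + l) - ((1ℚ - p) * g + p * (1ℚ - p) * ⟦ m ⟧))

  meanLeftEdges-pos : 0ℚ < p → ∀ m → (1ℚ - p) * ⟦ m ⟧ ≤ meanLeftEdges m + meanLeftEdges m
  meanLeftEdges-pos 0<p m = ℚ.*-cancelˡ-≤-pos p {{positive 0<p}} (slack _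
    (0≤+ (0≤- (potential m)) (0≤* 0≤1-p (0≤pairsMean excess m)))
    (solve 4 (λ p g l m → p :* ((con 1ℚ :- p) :* m)
       :+ (p :* (l :+ l) :- ((con 1ℚ :- p) :* g :+ p :* (con 1ℚ :- p) :* m) :+ (con 1ℚ :- p) :* g)
       := p :* (l :+ l)) refl p (meanExcess m) (meanLeftEdges m) ⟦ m ⟧))

  -- Either `n` is 0 and the power is 1, or `n` itself is at least 1. This bounds the decay from
  -- below once the mean excess vanishes.
  1≤p^n+n : ∀ n → 1ℚ ≤ p ^ n + ⟦ n ⟧
  1≤p^n+n zero    = ≤-refl
  1≤p^n+n (suc n) = +-mono-≤ (0≤^ 0≤p (suc n)) (⟦⟧-mono (ℕ.s≤s (ℕ.z≤n {n})))

  1≤meanDecay+meanExcess : ∀ m → 1ℚ ≤ meanDecay m + meanExcess m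
  1≤meanDecay+meanExcess m = begin
    1ℚ                                                ≡⟨ pairsMean-const 1ℚ m ⟨
    pairsMean (λ _ → 1ℚ) m                            ≤⟨ pairsMean-mono _ _ m (λ t → 1≤p^n+n (excess t)) ⟩
    pairsMean (λ t → p ^ excess t + ⟦ excess t ⟧) m   ≡⟨ pairsMean-+ (λ t → p ^ excess t) (λ t → ⟦ excess t ⟧) m ⟩
    meanDecay m + meanExcess m                        ∎
    where open ℚ.≤-Reasoning

  meanExcess-zero : p ≡ 0ℚ → ∀ m → meanExcess m ≤ 0ℚ
  meanExcess-zero p≡0 zero    = ≤-refl
  meanExcess-zero p≡0 (suc m) = ≤-trans (meanExcess-suc m) (≤-trans (≤-reflexive
    (trans (cong (λ q → meanExcess m + q * (meanDecay m + meanDecay m - 1ℚ)) p≡0)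
      (solve 2 (λ g y → g :+ con 0ℚ :* (y :+ y :- con 1ℚ) := g) refl (meanExcess m) (meanDecay m))))
    (meanExcess-zero p≡0 m))

  meanLeftEdges-zero : p ≡ 0ℚ → ∀ m → (1ℚ - p) * ⟦ m ⟧ ≤ meanLeftEdges m + meanLeftEdges m
  meanLeftEdges-zero p≡0 zero    = ≤-reflexive (ℚ.*-zeroʳ (1ℚ - p))
  -- A mean excess of at most 0 forces `meanDecay m` to be at least 1, so the doubled mean gains
  -- `2 (1 - p)` per pair, twice what is claimed.
  meanLeftEdges-zero p≡0 (suc m) = slack e
    (0≤+ (0≤+ (0≤+ hl hl) (0≤- (meanLeftEdges-zero p≡0 m))) (0≤* 0≤1-p (0≤+ (0≤+ hy hy) (0≤⟦⟧ 1))))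
    (trans (cong (λ n → (1ℚ - p) * n + e) (⟦⟧-+ 1 m))
      (solve 6 (λ p g l l′ y m → let hl = l′ :- (l :+ (con 1ℚ :- p) :* y) ; hy = (y :+ g :- con 1ℚ) :+ (con 0ℚ :- g) in
         (con 1ℚ :- p) :* (con 1ℚ :+ m)
           :+ (hl :+ hl :+ (l :+ l :- (con 1ℚ :- p) :* m) :+ (con 1ℚ :- p) :* (hy :+ hy :+ con 1ℚ))
         := l′ :+ l′) refl p g l l′ y ⟦ m ⟧))
    where
    g l l′ y e : ℚ
    g  = meanExcess m
    l  = meanLeftEdges m
    l′ = meanLeftEdges (suc m)
    y  = meanDecay m
    hl : 0ℚ ≤ l′ - (l + (1ℚ - p) * y)
    hl = 0≤- (meanLeftEdges-suc m)
    hy : 0ℚ ≤ (y + g - 1ℚ) + (0ℚ - g)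
    hy = 0≤+ (0≤- (1≤meanDecay+meanExcess m)) (0≤- (meanExcess-zero p≡0 m))
    e  = (l′ - (l + (1ℚ - p) * y)) + (l′ - (l + (1ℚ - p) * y)) + (l + l - (1ℚ - p) * ⟦ m ⟧)
         + (1ℚ - p) * ((y + g - 1ℚ + (0ℚ - g)) + (y + g - 1ℚ + (0ℚ - g)) + 1ℚ)

  -- Every walk runs to the root and nothing is rotated: each pair adds its larger key to the spine
  -- and hangs the smaller one to its left.
  meanRightSpine-one : p ≡ 1ℚ → ∀ m → ⟦ m ⟧ ≤ pairsMean (λ t → ⟦ rightSpine t ⟧) m
  meanRightSpine-one p≡1 zero    = ≤-refl
  meanRightSpine-one p≡1 (suc m) = begin
    ⟦ suc m ⟧
      ≡⟨ ⟦⟧-+ 1 m ⟩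
    1ℚ + ⟦ m ⟧
      ≤⟨ ℚ.+-monoʳ-≤ 1ℚ (meanRightSpine-one p≡1 m) ⟩
    1ℚ + pairsMean (λ t → ⟦ rightSpine t ⟧) m
      ≡⟨ cong (_+ pairsMean (λ t → ⟦ rightSpine t ⟧) m) (pairsMean-const 1ℚ m) ⟨
    pairsMean (λ _ → 1ℚ) m + pairsMean (λ t → ⟦ rightSpine t ⟧) m
      ≡⟨ pairsMean-+ (λ _ → 1ℚ) (λ t → ⟦ rightSpine t ⟧) m ⟨
    pairsMean (λ t → 1ℚ + ⟦ rightSpine t ⟧) m
      ≤⟨ Surely-Below m _ _ (λ t (s , b) → ≤-reflexive (grow b)) ⟩
    pairsMean (pairMean (λ t → ⟦ rightSpine t ⟧) (oddKey m)) m
      ≡⟨ pairsMean-suc (λ t → ⟦ rightSpine t ⟧) m ⟨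
    pairsMean (λ t → ⟦ rightSpine t ⟧) (suc m) ∎
    where
    open ℚ.≤-Reasoning
    spineLength : Tree → ℚ
    spineLength t = ⟦ rightSpine t ⟧
    grow : ∀ {k s t} → Below k s t → 1ℚ + ⟦ rightSpine t ⟧ ≡ pairMean spineLength k t
    grow {k} {s} {t} b = sym (trans (first-≡ (stepMean spineLength k) b)
      (trans (walkMean-one p≡1 (λ v → stepMean spineLength k (rebalanceAt v (graft (single (suc k)) t))) (replicate s R))
      (trans (second-≡ spineLength b)
      (trans (walkMean-one p≡1 (λ v → spineLength (rebalanceAt v (graft (twin k) t))) (L ∷ replicate s R))
      (trans (cong ⟦_⟧ (trans (Below-rightSpine (Below-twin b)) (cong suc (sym (Below-rightSpine b)))))
        (⟦⟧-+ 1 (rightSpine t)))))))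

  meanRightEdges-one : p ≡ 1ℚ → ∀ m → 1 ℕ.≤ m → ½ * ⟦ suc m ⟧ ≤ pairsMean (λ t → ⟦ rightEdges t ⟧) (suc m)
  -- From `x ≥ M - 1` the bound `x ≥ M / 2` follows once `M ≥ 2`, which is `1 ≤ m`.
  meanRightEdges-one p≡1 m 1≤m = slack (x + 1ℚ - M + ½ * (M - ⟦ 2 ⟧))
    (0≤+ (0≤- M≤x+1) (0≤* 0≤½ (0≤- (⟦⟧-mono (ℕ.s≤s 1≤m)))))
    (solve 2 (λ M x → con ½ :* M :+ (x :+ con 1ℚ :- M :+ con ½ :* (M :- con ⟦ 2 ⟧)) := x) refl M x)
    where
    open ℚ.≤-Reasoning
    M x : ℚ
    M = ⟦ suc m ⟧
    x = pairsMean (λ t → ⟦ rightEdges t ⟧) (suc m)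
    M≤x+1 : M ≤ x + 1ℚ
    M≤x+1 = begin
      M
        ≤⟨ meanRightSpine-one p≡1 (suc m) ⟩
      pairsMean (λ t → ⟦ rightSpine t ⟧) (suc m)
        ≤⟨ pairsMean-mono _ _ (suc m) (λ t → ≤-trans (⟦⟧-mono (rightSpine≤1+rightEdges t))
             (≤-reflexive (trans (⟦⟧-+ 1 (rightEdges t)) (ℚ.+-comm 1ℚ ⟦ rightEdges t ⟧)))) ⟩
      pairsMean (λ t → ⟦ rightEdges t ⟧ + 1ℚ) (suc m)
        ≡⟨ pairsMean-+ (λ t → ⟦ rightEdges t ⟧) (λ _ → 1ℚ) (suc m) ⟩
      x + pairsMean (λ _ → 1ℚ) (suc m)
        ≡⟨ cong (_+_ x) (pairsMean-const 1ℚ (suc m)) ⟩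
      x + 1ℚ ∎

  -- From path lengths and sizes to the average depth

  meanDepthSum : ℕ → ℚ
  meanDepthSum = pairsMean (λ t → ⟦ depthSum t ⟧)

  expectedAvgDepth-* : ∀ m → expectedAvgDepthPairs p m * ⟦ 2 ℕ.* suc m ⟧ ≡ meanDepthSum (suc m)
  expectedAvgDepth-* m = begin
    expectedAvgDepthPairs p m * N
      ≡⟨ ℚ.*-comm (expectedAvgDepthPairs p m) N ⟩
    N * pairsMean (avgDepth (suc (2 ℕ.* m))) (suc m)
      ≡⟨ pairsMean-* N (avgDepth (suc (2 ℕ.* m))) (suc m) ⟨
    pairsMean (λ t → N * avgDepth (suc (2 ℕ.* m)) t) (suc m)
      ≡⟨ expect-cong (λ t → trans (cong (λ n → ⟦ n ⟧ * avgDepth (suc (2 ℕ.* m)) t) (ℕ.*-suc 2 m))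
           (trans (ℚ.*-comm _ (avgDepth (suc (2 ℕ.* m)) t)) (/-⟦⟧ (depthSum t) (suc (2 ℕ.* m)))))
           (insertAll p (pairsSeq (suc m)) leaf) ⟩
    meanDepthSum (suc m) ∎
    where
    open ≡-Reasoning
    N : ℚ
    N = ⟦ 2 ℕ.* suc m ⟧

  -- Jensen's inequality for X², in the tangent form 2 a X ≤ a² + X² at a = c (m + 1).
  expectedAvgDepth-lower : ∀ (X : Tree → ℕ) → (∀ t → X t ℕ.* X t ℕ.≤ 2 ℕ.* depthSum t) →
    ∀ c m → 0ℚ ≤ c → c * ⟦ suc m ⟧ ≤ pairsMean (λ t → ⟦ X t ⟧) (suc m) →
    c * c * (+ 1 / 8) * ⟦ 2 ℕ.* suc m ⟧ ≤ expectedAvgDepthPairs p m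
  expectedAvgDepth-lower X X²≤ c m 0≤c hX =
    ℚ.*-cancelʳ-≤-pos ⟦ 2 ℕ.* suc m ⟧ {{ℚ.normalize-pos (2 ℕ.* suc m) 1}}
      (≤-trans half (≤-reflexive (sym (expectedAvgDepth-* m))))
    where
    M a x D : ℚ
    M = ⟦ suc m ⟧
    a = c * M
    x = pairsMean (λ t → ⟦ X t ⟧) (suc m)
    D = meanDepthSum (suc m)
    tangent : ∀ t → (a + a) * ⟦ X t ⟧ ≤ a * a + (1ℚ + 1ℚ) * ⟦ depthSum t ⟧
    -- The slack is `(X - a)²` plus the gap in `X² ≤ 2 depthSum`.
    tangent t = slack _ (0≤+ (0≤² (⟦ X t ⟧ - a))
        (0≤- (subst (_≤ ⟦ 2 ℕ.* depthSum t ⟧) (⟦⟧-* (X t) (X t)) (⟦⟧-mono (X²≤ t)))))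
      (trans (cong (λ n → (a + a) * ⟦ X t ⟧ + ((⟦ X t ⟧ - a) * (⟦ X t ⟧ - a) + (n - ⟦ X t ⟧ * ⟦ X t ⟧))) (⟦⟧-* 2 (depthSum t)))
        (solve 3 (λ a x d → (a :+ a) :* x :+ ((x :- a) :* (x :- a) :+ (con ⟦ 2 ⟧ :* d :- x :* x)) := a :* a :+ (con 1ℚ :+ con 1ℚ) :* d)
          refl a ⟦ X t ⟧ ⟦ depthSum t ⟧))
    mean : (a + a) * x ≤ a * a + (1ℚ + 1ℚ) * D
    mean = begin
      (a + a) * x
        ≡⟨ pairsMean-* (a + a) (λ t → ⟦ X t ⟧) (suc m) ⟨
      pairsMean (λ t → (a + a) * ⟦ X t ⟧) (suc m)
        ≤⟨ pairsMean-mono _ _ (suc m) tangent ⟩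
      pairsMean (λ t → a * a + (1ℚ + 1ℚ) * ⟦ depthSum t ⟧) (suc m)
        ≡⟨ pairsMean-+ (λ _ → a * a) (λ t → (1ℚ + 1ℚ) * ⟦ depthSum t ⟧) (suc m) ⟩
      pairsMean (λ _ → a * a) (suc m) + pairsMean (λ t → (1ℚ + 1ℚ) * ⟦ depthSum t ⟧) (suc m)
        ≡⟨ cong₂ _+_ (pairsMean-const (a * a) (suc m)) (pairsMean-* (1ℚ + 1ℚ) (λ t → ⟦ depthSum t ⟧) (suc m)) ⟩
      a * a + (1ℚ + 1ℚ) * D ∎
      where open ℚ.≤-Reasoning
    half : c * c * (+ 1 / 8) * ⟦ 2 ℕ.* suc m ⟧ * ⟦ 2 ℕ.* suc m ⟧ ≤ D
    -- Together with `x ≥ a`, `mean` gives `D ≥ a² / 2`. As `a = c M` and there are `2 M` nodes,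
    -- this is `c² / 8` times the square of the number of nodes.
    half = slack _ (0≤+ (0≤* {½} (0≤½) (0≤- mean)) (0≤* (0≤* 0≤c (0≤⟦⟧ (suc m))) (0≤- hX)))
      (trans (cong (λ n → c * c * (+ 1 / 8) * n * n + (½ * (a * a + (1ℚ + 1ℚ) * D - (a + a) * x) + a * (x - a))) (⟦⟧-* 2 (suc m)))
        (solve 4 (λ c M x D → c :* c :* con (+ 1 / 8) :* (con ⟦ 2 ⟧ :* M) :* (con ⟦ 2 ⟧ :* M)
          :+ (con ½ :* (c :* M :* (c :* M) :+ (con 1ℚ :+ con 1ℚ) :* D :- (c :* M :+ c :* M) :* x) :+ c :* M :* (x :- c :* M)) := D)
          refl c M x D))

  expectedAvgDepth-upper : ∀ m → expectedAvgDepthPairs p m ≤ 1ℚ * ⟦ 2 ℕ.* suc m ⟧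
  expectedAvgDepth-upper m = ℚ.*-cancelʳ-≤-pos N {{ℚ.normalize-pos n 1}} (begin
    expectedAvgDepthPairs p m * N  ≡⟨ expectedAvgDepth-* m ⟩
    meanDepthSum (suc m)           ≤⟨ size-insertAll (pairsSeq (suc m)) leaf _ _ bound ⟩
    pairsMean (λ _ → N * N) (suc m) ≡⟨ pairsMean-const (N * N) (suc m) ⟩
    N * N                          ≡⟨ cong (_* N) (ℚ.*-identityˡ N) ⟨
    1ℚ * N * N                     ∎)
    where
    open ℚ.≤-Reasoning
    n : ℕ
    n = 2 ℕ.* suc m
    N : ℚ
    N = ⟦ n ⟧
    bound : ∀ t → size t ℕ.≤ length (pairsSeq (suc m)) → ⟦ depthSum t ⟧ ≤ N * N
    bound t h = ≤-trans (⟦⟧-mono (ℕ.≤-trans (depthSumFrom≤ 0 t) (ℕ.*-mono-≤ h′ h′))) (≤-reflexive (⟦⟧-* n n))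
      where
      h′ : size t ℕ.≤ n
      h′ = subst (size t ℕ.≤_) (length-pairsSeq (suc m)) h

theorem7 : (p : ℚ) → 0ℚ ≤ p → p ≤ 1ℚ →
    ∃[ c₁ ] ∃[ c₂ ] ∃[ m₀ ] (0ℚ < c₁ × 0ℚ < c₂ ×
    (∀ (m : ℕ) → m₀ ℕ.≤ m →
    (c₁ * ((+ (2 ℕ.* suc m)) / 1) ≤ expectedAvgDepthPairs p m)
    × (expectedAvgDepthPairs p m ≤ c₂ * ((+ (2 ℕ.* suc m)) / 1))))
theorem7 p 0≤p p≤1 with ℚ.<-cmp p 1ℚ
... | tri> _ _ 1<p = ⊥-elim (ℚ.<-irrefl refl (ℚ.<-≤-trans 1<p p≤1))
-- At `p = 1` the constant from the leftmost path would be 0, so the right spine takes over with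
-- `c = ½`. After a single pair it has no edge yet, hence the threshold 1.
... | tri≈ _ p≡1 _ = ½ * ½ * (+ 1 / 8) , 1ℚ , 1 , ℚ.positive⁻¹ _ , ℚ.positive⁻¹ _ , λ m 1≤m →
  expectedAvgDepth-lower p 0≤p p≤1 rightEdges rightEdges²≤2depthSum ½ m 0≤½ (meanRightEdges-one p 0≤p p≤1 p≡1 m 1≤m) ,
  expectedAvgDepth-upper p 0≤p p≤1 m
... | tri< p<1 _ _ = c * c * (+ 1 / 8) , 1ℚ , 0 , 0<* (0<* 0<c 0<c) (ℚ.positive⁻¹ _) , ℚ.positive⁻¹ _ , λ m _ →
  expectedAvgDepth-lower p 0≤p p≤1 leftEdges leftEdges²≤2depthSum c m (ℚ.<⇒≤ 0<c) (halve (suc m) (linear (suc m))) ,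
  expectedAvgDepth-upper p 0≤p p≤1 m
  where
  -- `linear` bounds twice the mean, which accounts for the factor `½`.
  c : ℚ
  c = ½ * (1ℚ - p)
  0<c : 0ℚ < c
  0<c = 0<* (ℚ.positive⁻¹ ½) (subst (_< 1ℚ - p) (ℚ.+-inverseʳ p) (ℚ.+-monoˡ-< (ℚ.- p) p<1))
  l : ℕ → ℚ
  l = meanLeftEdges p 0≤p p≤1
  linear : ∀ m → (1ℚ - p) * ⟦ m ⟧ ≤ l m + l m
  linear with ℚ.<-cmp 0ℚ p
  ... | tri< 0<p _ _ = meanLeftEdges-pos p 0≤p p≤1 0<p
  ... | tri≈ _ 0≡p _ = meanLeftEdges-zero p 0≤p p≤1 (sym 0≡p)
  ... | tri> _ _ p<0 = ⊥-elim (ℚ.<-irrefl refl (ℚ.<-≤-trans p<0 0≤p))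
  halve : ∀ m → (1ℚ - p) * ⟦ m ⟧ ≤ l m + l m → c * ⟦ m ⟧ ≤ l m
  halve m h = slack (½ * (l m + l m - (1ℚ - p) * ⟦ m ⟧)) (0≤* 0≤½ (0≤- h))
    (solve 3 (λ p M l → con ½ :* (con 1ℚ :- p) :* M :+ con ½ :* (l :+ l :- (con 1ℚ :- p) :* M) := l) refl p ⟦ m ⟧ (l m))
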